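{- Let $(r_k)_{k\ge 1}$, $(s_k)_{k\ge 0}$, $(t_k)_{k\ge 1}$ be sequences of nonnegative real numbers, let $A=[a_{n,k}]_{n,k\ge 0}$ be the recursive matrix corresponding to these sequences, and let $J$ be its coefficient matrix. (i) For every positive integer $r$, if $J$ is TP$_r$, then $A$ is TP$_r$; likewise, if $J$ is TP, then $A$ is TP. (ii) If $A$ is TP$_2$, then the sequence $(a_{n,0})_{n\ge 0}$ is log-convex.
   Context: All matrices are real. A (finite or infinite) matrix is TP$_r$ (totally positive of order $r$) if all its minors of all orders $\le r$ are nonnegative; it is TP (totally positive) if its minors of all orders are nonnegative. The recursive matrix corresponding to nonnegative sequences $(r_k)_{k\ge1},(s_k)_{k\ge0},(t_k)_{k\ge1}$ is the infinite lower triangular matrix $A=[a_{n,k}]_{n,k\ge 0}$ with $a_{n,k}=0$ unless $n\ge k\ge 0$, defined by $a_{0,0}=1$, $a_{n+1,0}=s_0a_{n,0}+t_1a_{n,1}$, and $a_{n+1,k}=r_ka_{n,k-1}+s_ka_{n,k}+t_{k+1}a_{n,k+1}$ for $k\ge 1$, $n\ge 0$. The numbers $a_{n,0}$ are called its Catalan-like numbers. Its coefficient matrix is the infinite tridiagonal matrix $J=[J_{i,j}]_{i,j\ge 0}$ with $J_{k,k}=s_k$ for $k\ge0$, $J_{k-1,k}=r_k$ and $J_{k,k-1}=t_k$ for $k\ge 1$, and all other entries $0$. A sequence $(a_n)_{n\ge 0}$ of nonnegative numbers is log-convex if $a_ia_{j+1}\ge a_{i+1}a_j$ for all $0\le i<j$.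 -}

module Defs where

open import Level using (Level; 0ℓ; _⊔_)
open import Algebra.Bundles using (CommutativeRing; RawRing)
open import Data.Bool.Base using (if_then_else_)
open import Data.Fin.Base as Fin using (Fin; zero; suc; toℕ; punchIn)
open import Data.Nat.Base as ℕ using (ℕ; zero; suc; _≡ᵇ_)
import Data.Nat.Properties as ℕ
open import Data.Product using (∃; _×_; _,_)
open import Data.Rational as ℚ using (ℚ; 0ℚ; 1ℚ; ½; ∣_∣)
import Data.Rational.Properties as ℚ
open import Data.Rational.Solver using (module +-*-Solver)
open import Relation.Binary.Core using (Rel; _Preserves_⟶_)
open import Relation.Binary.PropositionalEquality
  using (_≡_; refl; sym; trans; cong; subst)

------------------------------------------------------------------------
-- Real numbers: Cauchy sequences of rationals, with the setoid equality
-- "the difference tends to 0".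

IsCauchy : (ℕ → ℚ) → Set
IsCauchy x = ∀ ε → 0ℚ ℚ.< ε →
  ∃ λ N → ∀ m n → N ℕ.≤ m → N ℕ.≤ n → ∣ x m ℚ.- x n ∣ ℚ.≤ ε

Eventually : (ℕ → Set) → Set
Eventually P = ∃ λ N → ∀ n → N ℕ.≤ n → P n

record ℝ : Set where
  no-eta-equality
  constructor mkℝ
  field
    seq    : ℕ → ℚ
    cauchy : IsCauchy seq

open ℝ public

infix 4 _≃ℝ_ _≤ℝ_

record _≃ℝ_ (x y : ℝ) : Set where
  constructor mk≃
  field
    close : ∀ ε → 0ℚ ℚ.< ε → Eventually λ n → ∣ seq x n ℚ.- seq y n ∣ ℚ.≤ ε

-- The slack ε makes the order invariant under _≃ℝ_.
record _≤ℝ_ (x y : ℝ) : Set where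
  constructor mk≤
  field
    below : ∀ ε → 0ℚ ℚ.< ε → Eventually λ n → seq x n ℚ.≤ seq y n ℚ.+ ε

open _≃ℝ_ public
open _≤ℝ_ public

private
  open ℚ.≤-Reasoning
  open +-*-Solver using (solve; _:=_; _:+_; _:*_; :-_; con)

  half-pos : ∀ {ε} → 0ℚ ℚ.< ε → 0ℚ ℚ.< ½ ℚ.* ε
  half-pos {ε} 0<ε = ℚ.positive⁻¹ (½ ℚ.* ε)
    where instance
      ε-pos : ℚ.Positive ε
      ε-pos = ℚ.positive 0<ε
      ½ε-pos : ℚ.Positive (½ ℚ.* ε)
      ½ε-pos = ℚ.pos*pos⇒pos ½ ε

  halves : ∀ ε → ½ ℚ.* ε ℚ.+ ½ ℚ.* ε ≡ ε
  halves ε = trans (sym (ℚ.*-distribʳ-+ ε ½ ½)) (ℚ.*-identityˡ ε)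

  scale : ∀ B {ε} → 0ℚ ℚ.< B → 0ℚ ℚ.< ε →
          ∃ λ δ → (0ℚ ℚ.< δ) × (B ℚ.* δ ≡ ½ ℚ.* ε)
  scale B {ε} 0<B 0<ε = δ , ℚ.positive⁻¹ δ , eq
    where
    instance
      B-pos : ℚ.Positive B
      B-pos = ℚ.positive 0<B
      B≢0 : ℚ.NonZero B
      B≢0 = ℚ.pos⇒nonZero B
      1/B-pos : ℚ.Positive (ℚ.1/ B)
      1/B-pos = ℚ.1/pos⇒pos B
      ½ε-pos : ℚ.Positive (½ ℚ.* ε)
      ½ε-pos = ℚ.positive (half-pos 0<ε)
    δ = ℚ.1/ B ℚ.* (½ ℚ.* ε)
    instance
      δ-pos : ℚ.Positive δ
      δ-pos = ℚ.pos*pos⇒pos (ℚ.1/ B) (½ ℚ.* ε)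
    eq : B ℚ.* δ ≡ ½ ℚ.* ε
    eq = trans (sym (ℚ.*-assoc B (ℚ.1/ B) (½ ℚ.* ε)))
        (trans (cong (ℚ._* (½ ℚ.* ε)) (ℚ.*-inverseʳ B)) (ℚ.*-identityˡ _))

  dist-sym : ∀ p q → ∣ p ℚ.- q ∣ ≡ ∣ q ℚ.- p ∣
  dist-sym p q = trans (sym (ℚ.∣-p∣≡∣p∣ (p ℚ.- q)))
    (cong ∣_∣ (solve 2 (λ p q → :- (p :+ :- q) := q :+ :- p) refl p q))

  triangle : ∀ p q r → ∣ p ℚ.- r ∣ ℚ.≤ ∣ p ℚ.- q ∣ ℚ.+ ∣ q ℚ.- r ∣
  triangle p q r = subst (ℚ._≤ ∣ p ℚ.- q ∣ ℚ.+ ∣ q ℚ.- r ∣)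
    (cong ∣_∣ (solve 3 (λ p q r →
      (p :+ :- q) :+ (q :+ :- r) := p :+ :- r) refl p q r))
    (ℚ.∣p+q∣≤∣p∣+∣q∣ (p ℚ.- q) (q ℚ.- r))

  +-dist : ∀ a b c d → ∣ (a ℚ.+ b) ℚ.- (c ℚ.+ d) ∣ ℚ.≤ ∣ a ℚ.- c ∣ ℚ.+ ∣ b ℚ.- d ∣
  +-dist a b c d = subst (ℚ._≤ ∣ a ℚ.- c ∣ ℚ.+ ∣ b ℚ.- d ∣)
    (cong ∣_∣ (solve 4 (λ a b c d →
      (a :+ :- c) :+ (b :+ :- d) := (a :+ b) :+ :- (c :+ d)) refl a b c d))
    (ℚ.∣p+q∣≤∣p∣+∣q∣ (a ℚ.- c) (b ℚ.- d))

  neg-dist : ∀ a b → ∣ ℚ.- a ℚ.- ℚ.- b ∣ ≡ ∣ a ℚ.- b ∣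
  neg-dist a b = trans
    (cong ∣_∣ (solve 2 (λ a b → :- a :+ :- :- b := :- (a :+ :- b)) refl a b))
    (ℚ.∣-p∣≡∣p∣ (a ℚ.- b))

  self-dist : ∀ p → ∣ p ℚ.- p ∣ ≡ 0ℚ
  self-dist p = cong ∣_∣ (ℚ.+-inverseʳ p)

  +-bound : ∀ a b c d {ε} → ∣ a ℚ.- c ∣ ℚ.≤ ½ ℚ.* ε → ∣ b ℚ.- d ∣ ℚ.≤ ½ ℚ.* ε →
            ∣ (a ℚ.+ b) ℚ.- (c ℚ.+ d) ∣ ℚ.≤ ε
  +-bound a b c d {ε} p q =
    ℚ.≤-trans (+-dist a b c d) (subst (_ ℚ.≤_) (halves ε) (ℚ.+-mono-≤ p q))

  *-bound : ∀ a b c d {B δ ε} → ∣ a ∣ ℚ.≤ B → ∣ d ∣ ℚ.≤ B →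
            0ℚ ℚ.≤ B → 0ℚ ℚ.≤ δ → B ℚ.* δ ≡ ½ ℚ.* ε →
            ∣ a ℚ.- c ∣ ℚ.≤ δ → ∣ b ℚ.- d ∣ ℚ.≤ δ →
            ∣ (a ℚ.* b) ℚ.- (c ℚ.* d) ∣ ℚ.≤ ε
  *-bound a b c d {B} {δ} {ε} a≤B d≤B 0≤B 0≤δ eq ac bd = begin
    ∣ (a ℚ.* b) ℚ.- (c ℚ.* d) ∣
      ≡⟨ cong ∣_∣ (solve 4 (λ a b c d →
           (a :* b) :+ :- (c :* d) := (a :* (b :+ :- d)) :+ (d :* (a :+ :- c)))
           refl a b c d) ⟩
    ∣ a ℚ.* (b ℚ.- d) ℚ.+ d ℚ.* (a ℚ.- c) ∣
      ≤⟨ ℚ.∣p+q∣≤∣p∣+∣q∣ (a ℚ.* (b ℚ.- d)) (d ℚ.* (a ℚ.- c)) ⟩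
    ∣ a ℚ.* (b ℚ.- d) ∣ ℚ.+ ∣ d ℚ.* (a ℚ.- c) ∣
      ≤⟨ ℚ.+-mono-≤ (product a (b ℚ.- d) a≤B bd) (product d (a ℚ.- c) d≤B ac) ⟩
    ½ ℚ.* ε ℚ.+ ½ ℚ.* ε  ≡⟨ halves ε ⟩
    ε ∎
    where
    instance
      δ-nonNeg : ℚ.NonNegative δ
      δ-nonNeg = ℚ.nonNegative 0≤δ
    product : ∀ p q → ∣ p ∣ ℚ.≤ B → ∣ q ∣ ℚ.≤ δ → ∣ p ℚ.* q ∣ ℚ.≤ ½ ℚ.* ε
    product p q p≤B q≤δ = begin
      ∣ p ℚ.* q ∣      ≡⟨ ℚ.∣p*q∣≡∣p∣*∣q∣ p q ⟩
      ∣ p ∣ ℚ.* ∣ q ∣  ≤⟨ ℚ.*-monoˡ-≤-nonNeg ∣ p ∣ {{ℚ.nonNegative (ℚ.0≤∣p∣ p)}} q≤δ ⟩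
      ∣ p ∣ ℚ.* δ      ≤⟨ ℚ.*-monoʳ-≤-nonNeg δ p≤B ⟩
      B ℚ.* δ          ≡⟨ eq ⟩
      ½ ℚ.* ε          ∎

-- Only eventual boundedness is needed, so no maximum over an initial
-- segment has to be taken.
bounded : ∀ x → ∃ λ B → (0ℚ ℚ.< B) × Eventually λ n → ∣ seq x n ∣ ℚ.≤ B
bounded x with cauchy x 1ℚ (ℚ.positive⁻¹ 1ℚ)
... | N , xN = B , 0<B , N , bound
  where
  B = 1ℚ ℚ.+ ∣ seq x N ∣
  0<B : 0ℚ ℚ.< B
  0<B = ℚ.+-mono-<-≤ (ℚ.positive⁻¹ 1ℚ) (ℚ.0≤∣p∣ (seq x N))
  bound : ∀ n → N ℕ.≤ n → ∣ seq x n ∣ ℚ.≤ B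
  bound n N≤n = begin
    ∣ seq x n ∣
      ≡⟨ cong ∣_∣ (solve 2 (λ p q → p := (p :+ :- q) :+ q) refl (seq x n) (seq x N)) ⟩
    ∣ (seq x n ℚ.- seq x N) ℚ.+ seq x N ∣
      ≤⟨ ℚ.∣p+q∣≤∣p∣+∣q∣ (seq x n ℚ.- seq x N) (seq x N) ⟩
    ∣ seq x n ℚ.- seq x N ∣ ℚ.+ ∣ seq x N ∣
      ≤⟨ ℚ.+-monoˡ-≤ ∣ seq x N ∣ (xN n N N≤n ℕ.≤-refl) ⟩
    B ∎

private
  +-pos : ∀ p q → 0ℚ ℚ.< p → 0ℚ ℚ.< q → 0ℚ ℚ.< p ℚ.+ q
  +-pos p q 0<p 0<q = ℚ.+-mono-< {0ℚ} {p} {0ℚ} {q} 0<p 0<q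

  p≤p+q : ∀ p q → 0ℚ ℚ.< q → p ℚ.≤ p ℚ.+ q
  p≤p+q p q 0<q = subst (ℚ._≤ p ℚ.+ q) (ℚ.+-identityʳ p)
    (ℚ.+-monoʳ-≤ p {0ℚ} {q} (ℚ.<⇒≤ 0<q))

  q≤p+q : ∀ p q → 0ℚ ℚ.< p → q ℚ.≤ p ℚ.+ q
  q≤p+q p q 0<p = subst (ℚ._≤ p ℚ.+ q) (ℚ.+-identityˡ q)
    (ℚ.+-monoˡ-≤ q {0ℚ} {p} (ℚ.<⇒≤ 0<p))

  commonBound : ∀ x y → ∃ λ B → (0ℚ ℚ.< B) ×
    Eventually λ n → (∣ seq x n ∣ ℚ.≤ B) × (∣ seq y n ∣ ℚ.≤ B)
  commonBound x y =
    let (B , 0<B , M , p) = bounded x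
        (C , 0<C , N , q) = bounded y
    in B ℚ.+ C , +-pos B C 0<B 0<C , M ℕ.⊔ N , λ n h →
      ℚ.≤-trans (p n (ℕ.m⊔n≤o⇒m≤o M N h)) (p≤p+q B C 0<C) ,
      ℚ.≤-trans (q n (ℕ.m⊔n≤o⇒n≤o M N h)) (q≤p+q B C 0<B)

  pointwise : ∀ {x y} → (∀ n → seq x n ≡ seq y n) → x ≃ℝ y
  pointwise {x} {y} eq = mk≃ λ ε 0<ε → 0 , λ n _ →
    subst (ℚ._≤ ε)
      (sym (trans (cong (λ p → ∣ p ℚ.- seq y n ∣) (eq n)) (self-dist (seq y n))))
      (ℚ.<⇒≤ 0<ε)

infixl 6 _+ℝ_
infixl 7 _*ℝ_
infix  8 -ℝ_

constℝ : ℚ → ℝ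
constℝ q .seq _ = q
constℝ q .cauchy ε 0<ε =
  0 , λ _ _ _ _ → subst (ℚ._≤ ε) (sym (self-dist q)) (ℚ.<⇒≤ 0<ε)

0ℝ 1ℝ : ℝ
0ℝ = constℝ 0ℚ
1ℝ = constℝ 1ℚ

_+ℝ_ : ℝ → ℝ → ℝ
(x +ℝ y) .seq n = seq x n ℚ.+ seq y n
(x +ℝ y) .cauchy ε 0<ε
  with cauchy x (½ ℚ.* ε) (half-pos 0<ε) | cauchy y (½ ℚ.* ε) (half-pos 0<ε)
... | M , p | N , q = M ℕ.⊔ N , λ m n hm hn →
  +-bound (seq x m) (seq y m) (seq x n) (seq y n)
    (p m n (ℕ.m⊔n≤o⇒m≤o M N hm) (ℕ.m⊔n≤o⇒m≤o M N hn))
    (q m n (ℕ.m⊔n≤o⇒n≤o M N hm) (ℕ.m⊔n≤o⇒n≤o M N hn))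

-ℝ_ : ℝ → ℝ
(-ℝ x) .seq n = ℚ.- seq x n
(-ℝ x) .cauchy ε 0<ε with cauchy x ε 0<ε
... | N , p = N , λ m n hm hn →
  subst (ℚ._≤ ε) (sym (neg-dist (seq x m) (seq x n))) (p m n hm hn)

_*ℝ_ : ℝ → ℝ → ℝ
(x *ℝ y) .seq n = seq x n ℚ.* seq y n
(x *ℝ y) .cauchy ε 0<ε =
  let (B , 0<B , K , b) = commonBound x y
      (δ , 0<δ , eq)    = scale B 0<B 0<ε
      (M , p)           = cauchy x δ 0<δ
      (N , q)           = cauchy y δ 0<δ
  in K ℕ.⊔ (M ℕ.⊔ N) , λ m n hm hn →
    let hm′      = ℕ.m⊔n≤o⇒n≤o K (M ℕ.⊔ N) hm
        hn′      = ℕ.m⊔n≤o⇒n≤o K (M ℕ.⊔ N) hn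
        (bx , _) = b m (ℕ.m⊔n≤o⇒m≤o K (M ℕ.⊔ N) hm)
        (_ , by) = b n (ℕ.m⊔n≤o⇒m≤o K (M ℕ.⊔ N) hn)
    in *-bound (seq x m) (seq y m) (seq x n) (seq y n) bx by
         (ℚ.<⇒≤ 0<B) (ℚ.<⇒≤ 0<δ) eq
         (p m n (ℕ.m⊔n≤o⇒m≤o M N hm′) (ℕ.m⊔n≤o⇒m≤o M N hn′))
         (q m n (ℕ.m⊔n≤o⇒n≤o M N hm′) (ℕ.m⊔n≤o⇒n≤o M N hn′))

private
  ≃-refl : ∀ {x} → x ≃ℝ x
  ≃-refl = pointwise λ _ → refl

  ≃-sym : ∀ {x y} → x ≃ℝ y → y ≃ℝ x
  ≃-sym {x} {y} p = mk≃ λ ε 0<ε → let (N , h) = close p ε 0<ε in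
    N , λ n le → subst (ℚ._≤ ε) (dist-sym (seq x n) (seq y n)) (h n le)

  ≃-trans : ∀ {x y z} → x ≃ℝ y → y ≃ℝ z → x ≃ℝ z
  ≃-trans {x} {y} {z} p q = mk≃ λ ε 0<ε →
    let (M , h) = close p (½ ℚ.* ε) (half-pos 0<ε)
        (N , k) = close q (½ ℚ.* ε) (half-pos 0<ε)
    in M ℕ.⊔ N , λ n le →
      ℚ.≤-trans (triangle (seq x n) (seq y n) (seq z n))
        (subst (_ ℚ.≤_) (halves ε)
          (ℚ.+-mono-≤ (h n (ℕ.m⊔n≤o⇒m≤o M N le)) (k n (ℕ.m⊔n≤o⇒n≤o M N le))))

  +-cong : ∀ {x x′ y y′} → x ≃ℝ x′ → y ≃ℝ y′ → x +ℝ y ≃ℝ x′ +ℝ y′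
  +-cong {x} {x′} {y} {y′} p q = mk≃ λ ε 0<ε →
    let (M , h) = close p (½ ℚ.* ε) (half-pos 0<ε)
        (N , k) = close q (½ ℚ.* ε) (half-pos 0<ε)
    in M ℕ.⊔ N , λ n le →
      +-bound (seq x n) (seq y n) (seq x′ n) (seq y′ n)
        (h n (ℕ.m⊔n≤o⇒m≤o M N le)) (k n (ℕ.m⊔n≤o⇒n≤o M N le))

  -‿cong : ∀ {x y} → x ≃ℝ y → -ℝ x ≃ℝ -ℝ y
  -‿cong {x} {y} p = mk≃ λ ε 0<ε → let (N , h) = close p ε 0<ε in
    N , λ n le → subst (ℚ._≤ ε) (sym (neg-dist (seq x n) (seq y n))) (h n le)

  *-cong : ∀ {x x′ y y′} → x ≃ℝ x′ → y ≃ℝ y′ → x *ℝ y ≃ℝ x′ *ℝ y′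
  *-cong {x} {x′} {y} {y′} p q = mk≃ λ ε 0<ε →
    let (B , 0<B , K , b) = commonBound x y′
        (δ , 0<δ , eq)    = scale B 0<B 0<ε
        (M , h)           = close p δ 0<δ
        (N , k)           = close q δ 0<δ
    in K ℕ.⊔ (M ℕ.⊔ N) , λ n le →
      let le′      = ℕ.m⊔n≤o⇒n≤o K (M ℕ.⊔ N) le
          (bx , by) = b n (ℕ.m⊔n≤o⇒m≤o K (M ℕ.⊔ N) le)
      in *-bound (seq x n) (seq y n) (seq x′ n) (seq y′ n) bx by
           (ℚ.<⇒≤ 0<B) (ℚ.<⇒≤ 0<δ) eq
           (h n (ℕ.m⊔n≤o⇒m≤o M N le′)) (k n (ℕ.m⊔n≤o⇒n≤o M N le′))

ℝ-commutativeRing : CommutativeRing 0ℓ 0ℓ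
ℝ-commutativeRing = record
  { Carrier = ℝ
  ; _≈_     = _≃ℝ_
  ; _+_     = _+ℝ_
  ; _*_     = _*ℝ_
  ; -_      = -ℝ_
  ; 0#      = 0ℝ
  ; 1#      = 1ℝ
  ; isCommutativeRing = record
    { isRing = record
      { +-isAbelianGroup = record
        { isGroup = record
          { isMonoid = record
            { isSemigroup = record
              { isMagma = record
                { isEquivalence = record
                  { refl = ≃-refl ; sym = ≃-sym ; trans = ≃-trans }
                ; ∙-cong = +-cong
                }
              ; assoc = λ x y z → pointwise λ n → ℚ.+-assoc (seq x n) (seq y n) (seq z n)
              }
            ; identity = (λ x → pointwise λ n → ℚ.+-identityˡ (seq x n))
                       , (λ x → pointwise λ n → ℚ.+-identityʳ (seq x n))
            }
          ; inverse = (λ x → pointwise λ n → ℚ.+-inverseˡ (seq x n))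
                    , (λ x → pointwise λ n → ℚ.+-inverseʳ (seq x n))
          ; ⁻¹-cong = -‿cong
          }
        ; comm = λ x y → pointwise λ n → ℚ.+-comm (seq x n) (seq y n)
        }
      ; *-cong     = *-cong
      ; *-assoc    = λ x y z → pointwise λ n → ℚ.*-assoc (seq x n) (seq y n) (seq z n)
      ; *-identity = (λ x → pointwise λ n → ℚ.*-identityˡ (seq x n))
                   , (λ x → pointwise λ n → ℚ.*-identityʳ (seq x n))
      ; distrib    = (λ x y z → pointwise λ n → ℚ.*-distribˡ-+ (seq x n) (seq y n) (seq z n))
                   , (λ x y z → pointwise λ n → ℚ.*-distribʳ-+ (seq x n) (seq y n) (seq z n))
      }
    ; *-comm = λ x y → pointwise λ n → ℚ.*-comm (seq x n) (seq y n)
    }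
  }

------------------------------------------------------------------------
-- Nothing below depends on how the reals are built, so it is stated for a
-- commutative ring with a relation _≤_ and then instantiated at ℝ.

module TotalPositivity
  {c ℓ ℓ′ : Level} (R : CommutativeRing c ℓ)
  (_≤_ : Rel (CommutativeRing.Carrier R) ℓ′)
  where

  open CommutativeRing R
    using (Carrier; _≈_; _+_; _*_; -_; 0#; 1#; rawRing)

  open import Algebra.Definitions.RawSemiring (RawRing.rawSemiring rawRing) using (sum; _^_)

  InfiniteMatrix : Set c
  InfiniteMatrix = ℕ → ℕ → Carrier

  -- Laplace expansion along the first row.
  det : ∀ {n} → (Fin n → Fin n → Carrier) → Carrier
  det {zero}  M = 1#
  det {suc n} M = sum λ j →
    ((- 1#) ^ toℕ j) * (M zero j * det λ i k → M (suc i) (punchIn j k))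

  StrictlyIncreasing : ∀ {k} → (Fin k → ℕ) → Set
  StrictlyIncreasing I = I Preserves Fin._<_ ⟶ ℕ._<_

  minor : ∀ {k} → InfiniteMatrix → (rows cols : Fin k → ℕ) → Carrier
  minor M rows cols = det λ i j → M (rows i) (cols j)

  MinorsNonneg : ℕ → InfiniteMatrix → Set ℓ′
  MinorsNonneg k M = (rows cols : Fin k → ℕ) →
    StrictlyIncreasing rows → StrictlyIncreasing cols → 0# ≤ minor M rows cols

  TP[_] : ℕ → InfiniteMatrix → Set ℓ′
  TP[ p ] M = ∀ k → 1 ℕ.≤ k → k ℕ.≤ p → MinorsNonneg k M

  TP : InfiniteMatrix → Set ℓ′
  TP M = ∀ k → 1 ℕ.≤ k → MinorsNonneg k M

  -- Here and below the values r 0 and t 0 are never used: the sequences r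
  -- and t are indexed from 1.  The entries above the diagonal vanish, see
  -- recursiveMatrix-lowerTriangular.
  recursiveMatrix : (r s t : ℕ → Carrier) → InfiniteMatrix
  recursiveMatrix r s t zero    zero    = 1#
  recursiveMatrix r s t zero    (suc k) = 0#
  recursiveMatrix r s t (suc n) zero    =
    s 0 * recursiveMatrix r s t n 0 + t 1 * recursiveMatrix r s t n 1
  recursiveMatrix r s t (suc n) (suc k) =
    r (suc k) * recursiveMatrix r s t n k
      + s (suc k) * recursiveMatrix r s t n (suc k)
      + t (suc (suc k)) * recursiveMatrix r s t n (suc (suc k))

  coefficientMatrix : (r s t : ℕ → Carrier) → InfiniteMatrix
  coefficientMatrix r s t i j =
    if i ≡ᵇ j     then s i else
    if suc i ≡ᵇ j then r j else
    if i ≡ᵇ suc j then t i else 0#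

  catalanLike : (r s t : ℕ → Carrier) → ℕ → Carrier
  catalanLike r s t n = recursiveMatrix r s t n 0

  LogConvex : (ℕ → Carrier) → Set ℓ′
  LogConvex a =
    (∀ n → 0# ≤ a n) ×
    (∀ i j → i ℕ.< j → (a (suc i) * a j) ≤ (a i * a (suc j)))

  recursiveMatrix-lowerTriangular :
    ∀ r s t {n k} → n ℕ.< k → recursiveMatrix r s t n k ≈ 0#
  recursiveMatrix-lowerTriangular r s t {zero}  {suc k} _ = CommutativeRing.refl R
  recursiveMatrix-lowerTriangular r s t {suc n} {suc k} (ℕ.s≤s n<k) =
    R.trans (R.+-cong (R.+-cong (kill (r (suc k)) n<k)
                                (kill (s (suc k)) (ℕ.m<n⇒m<1+n n<k)))
                      (kill (t (suc (suc k))) (ℕ.m<n⇒m<1+n (ℕ.m<n⇒m<1+n n<k))))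
            (R.trans (R.+-identityʳ _) (R.+-identityʳ 0#))
    where
    module R = CommutativeRing R
    kill : ∀ x {j} → n ℕ.< j → x * recursiveMatrix r s t n j ≈ 0#
    kill x n<j = R.trans
      (R.*-cong R.refl (recursiveMatrix-lowerTriangular r s t n<j)) (R.zeroʳ x)

open TotalPositivity ℝ-commutativeRing _≤ℝ_ public

{-# OPTIONS --safe #-}
module Submission where

-- Row n + 1 of the recursive matrix A is row n of A times the coefficient
-- matrix J.  A minor of A whose rows are all positive, i + 1 for i in I, is
-- therefore a minor of the product A J with rows I, and by the Cauchy-Binet
-- formula it is a sum over L of products
--
--   (minor of A with rows I, columns L) * (minor of J with rows L, columns K).
--
-- The first factor has smaller row indices, so it is nonnegative by
-- induction on a bound for the rows, and the second by hypothesis.  A minor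
-- that does use row 0 reduces to the previous kind, because row 0 of A is
-- (1, 0, 0, ...): either column 0 is used as well, and Laplace expansion
-- removes both, or the minor vanishes.  Since the orders of the minors never
-- grow, this settles the statement for TP of order p, for every p, and hence
-- for TP.
--
-- For log-convexity, the recurrence for column 0 gives
--
--   a(i,0) a(j+1,0) - a(i+1,0) a(j,0) = t(1) (a(i,0) a(j,1) - a(i,1) a(j,0)),
--
-- where t(1) is nonnegative and the last bracket is the minor of A with rows
-- i < j and columns 0, 1.
--
-- Minors are handled as coefficients of exterior products of rows.  A form
-- assigns a coefficient to each list of columns, and exterior multiplication
-- by a row is defined by recursion on that list, which is Laplace expansion
-- (laplace, det≈minors).  Multiplication by a matrix induces a map of forms,
-- push, which commutes with exterior multiplication (push-∧); this is the
-- Cauchy-Binet formula (cauchy-binet), and its proof needs only that rows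
-- anticommute and square to zero (∧-anticomm, ∧-alternating).  The map push
-- is a combination of minors whose coefficients are those of the form it is
-- applied to, whence positivity (push-nonneg).

open import Level using (Level; _⊔_)
open import Algebra.Bundles using (CommutativeRing; Semiring)
import Algebra.Properties.Ring as RingProperties
import Algebra.Properties.Semiring.Sum as SemiringSum
import Algebra.Definitions.RawSemiring as RawSemiring
import Algebra.Solver.Ring.NaturalCoefficients.Default as SemiringSolver
open import Data.Fin.Base using (Fin; zero; suc; toℕ; punchIn)
open import Data.List.Base using (List; []; _∷_; length; lookup; map; tabulate)
open import Data.List.Properties using (length-map; length-tabulate; tabulate-lookup)
open import Data.List.Relation.Unary.All as All using (All; []; _∷_)
import Data.List.Relation.Unary.All.Properties as All
open import Data.List.Relation.Unary.AllPairs as AllPairs using (AllPairs; []; _∷_)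
import Data.List.Relation.Unary.AllPairs.Properties as AllPairs
open import Data.List.Membership.Propositional.Properties using (∈-lookup)
open import Data.Nat.Base as ℕ using (ℕ; zero; suc; _≤_; _<_; z≤n; s≤s)
import Data.Nat.Properties as ℕ
open import Data.Product using (∃; _×_; _,_)
open import Data.Rational as ℚ using (ℚ; 0ℚ; 1ℚ; ½; ∣_∣)
import Data.Rational.Properties as ℚ
open import Data.Rational.Solver using (module +-*-Solver)
open import Data.Sum.Base using (inj₁; inj₂)
open import Function.Base using (_∘_)
open import Relation.Binary.Core using (Rel)
open import Relation.Binary.PropositionalEquality as ≡ using (_≡_; _≢_)
open import Relation.Nullary using (yes; no; contradiction)
open import Defs

-- Forms and exterior multiplication over a commutative ring

module Forms {c ℓ : Level} (R : CommutativeRing c ℓ) where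

  open CommutativeRing R hiding (zero)
  open import Relation.Binary.Reasoning.Setoid setoid
  private
    module RingProps = RingProperties ring
    module Solver = SemiringSolver commutativeSemiring
    open Solver using (solve; _:=_; _:+_; _:*_; con)

  -- The sign -1.  Writing it as a factor turns rearrangements into identities of
  -- commutative semirings, with σ as one more variable; cancellation then enters
  -- only through σσ≈1 and x+σx≈0.
  σ : Carrier
  σ = - 1#

  -- An alternating form, given by its coefficients on increasing lists of
  -- columns.  It is defined on all lists, so that forms of every degree live in
  -- one type; the values on other lists play no role.
  Form : Set c
  Form = List ℕ → Carrier

  infix 4 _≋_
  _≋_ : Form → Form → Set ℓ
  ω ≋ η = ∀ K → ω K ≈ η K

  -- Exterior multiplication by the vector v.  Its coefficient at a list of
  -- columns is the alternating sum, over the ways of removing one column k from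
  -- the list, of v k times the coefficient of ω at the remaining columns.
  infixr 7 _∧_
  _∧_ : (ℕ → Carrier) → Form → Form
  (v ∧ ω) []      = 0#
  (v ∧ ω) (k ∷ K) = v k * ω K + σ * (v ∧ (ω ∘ (k ∷_))) K

  -- The unit of degree zero.
  one : Form
  one []      = 1#
  one (_ ∷ _) = 0#

  -- The exterior product of the rows I of M; its coefficient at K is the minor
  -- of M with rows I and columns K, and 0 when I and K differ in length.
  minors : (ℕ → ℕ → Carrier) → List ℕ → Form
  minors M []      = one
  minors M (i ∷ I) = M i ∧ minors M I

  σσ≈1 : σ * σ ≈ 1#
  σσ≈1 = begin
    - 1# * - 1#  ≈⟨ RingProps.-1*x≈-x (- 1#) ⟩
    - - 1#       ≈⟨ RingProps.-‿involutive 1# ⟩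
    1#           ∎

  x+σx≈0 : ∀ x → x + σ * x ≈ 0#
  x+σx≈0 x = begin
    x + σ * x       ≈⟨ +-congˡ (RingProps.-1*x≈-x x) ⟩
    x + - x         ≈⟨ -‿inverseʳ x ⟩
    0#              ∎

  -- Linear functionals on forms, required to respect pointwise equality.
  record Linear (Φ : Form → Carrier) : Set (c ⊔ ℓ) where
    field
      cong   : ∀ {ω η} → ω ≋ η → Φ ω ≈ Φ η
      +-homo : ∀ ω η → Φ (λ K → ω K + η K) ≈ Φ ω + Φ η
      *-homo : ∀ a ω → Φ (λ K → a * ω K) ≈ a * Φ ω

    0-homo : Φ (λ _ → 0#) ≈ 0#
    0-homo = begin
      Φ (λ _ → 0#)       ≈⟨ cong (λ _ → zeroˡ 0#) ⟨
      Φ (λ _ → 0# * 0#)  ≈⟨ *-homo 0# (λ _ → 0#) ⟩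
      0# * Φ (λ _ → 0#)  ≈⟨ zeroˡ _ ⟩
      0#                 ∎

  evaluation-linear : ∀ K → Linear (λ ω → ω K)
  evaluation-linear K = record
    { cong   = λ p → p K
    ; +-homo = λ _ _ → refl
    ; *-homo = λ _ _ → refl
    }

  -- Only the entries of a vector at the columns in K matter at K.
  ∧-cong-on : ∀ {p} {P : ℕ → Set p} {u v ω η} →
    (∀ {k} → P k → u k ≈ v k) → (∀ {K} → All P K → ω K ≈ η K) →
    ∀ {K} → All P K → (u ∧ ω) K ≈ (v ∧ η) K
  ∧-cong-on u≈v ω≈η []       = refl
  ∧-cong-on u≈v ω≈η (p ∷ ps) = +-cong (*-cong (u≈v p) (ω≈η ps))
    (*-congˡ (∧-cong-on u≈v (λ qs → ω≈η (p ∷ qs)) ps))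

  ∧-congˡ : ∀ {v ω η} → ω ≋ η → v ∧ ω ≋ v ∧ η
  ∧-congˡ         ω≋η []      = refl
  ∧-congˡ {v = v} ω≋η (k ∷ K) =
    +-cong (*-congˡ (ω≋η K)) (*-congˡ (∧-congˡ {v} (ω≋η ∘ (k ∷_)) K))

  ∧-linear : ∀ v K → Linear (λ ω → (v ∧ ω) K)
  ∧-linear v K = record
    { cong   = λ p → ∧-congˡ {v} p K
    ; +-homo = λ ω η → plus ω η K
    ; *-homo = λ a ω → times a ω K
    }
    where
    plus : ∀ ω η → v ∧ (λ L → ω L + η L) ≋ λ L → (v ∧ ω) L + (v ∧ η) L
    plus ω η []      = sym (+-identityˡ 0#)
    plus ω η (k ∷ K) = trans
      (+-congˡ (*-congˡ (plus (ω ∘ (k ∷_)) (η ∘ (k ∷_)) K)))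
      (solve 6 (λ x y z s u w →
         x :* (y :+ z) :+ s :* (u :+ w) := (x :* y :+ s :* u) :+ (x :* z :+ s :* w))
         refl (v k) (ω K) (η K) σ _ _)
    times : ∀ a ω → v ∧ (λ L → a * ω L) ≋ λ L → a * (v ∧ ω) L
    times a ω []      = sym (zeroʳ a)
    times a ω (k ∷ K) = trans
      (+-congˡ (*-congˡ (times a (ω ∘ (k ∷_)) K)))
      (solve 5 (λ a x y s u →
         x :* (a :* y) :+ s :* (a :* u) := a :* (x :* y :+ s :* u))
         refl a (v k) (ω K) σ _)

  module ∧ v K = Linear (∧-linear v K)

  ∘∧-linear : ∀ {Φ} v → Linear Φ → Linear (Φ ∘ (v ∧_))
  ∘∧-linear v Φ-lin = record
    { cong   = λ p → Φ.cong (∧-congˡ {v} p)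
    ; +-homo = λ ω η → trans (Φ.cong (λ K → ∧.+-homo v K ω η)) (Φ.+-homo _ _)
    ; *-homo = λ a ω → trans (Φ.cong (λ K → ∧.*-homo v K a ω)) (Φ.*-homo a _)
    }
    where module Φ = Linear Φ-lin

  ∧-linearˡ : ∀ a u w ω → (λ k → a * u k + w k) ∧ ω ≋ λ K → a * (u ∧ ω) K + (w ∧ ω) K
  ∧-linearˡ a u w ω []      = sym (trans (+-identityʳ _) (zeroʳ a))
  ∧-linearˡ a u w ω (k ∷ K) = trans
    (+-congˡ (*-congˡ (∧-linearˡ a u w (ω ∘ (k ∷_)) K)))
    (solve 7 (λ a x y z s p q →
       (a :* x :+ y) :* z :+ s :* (a :* p :+ q)
         := a :* (x :* z :+ s :* p) :+ (y :* z :+ s :* q))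
       refl a (u k) (w k) (ω K) σ _ _)

  ∧-vanish : ∀ {v} ω {K} → All (λ k → v k ≈ 0#) K → (v ∧ ω) K ≈ 0#
  ∧-vanish     ω []                = refl
  ∧-vanish {v} ω {k ∷ K} (p ∷ ps) = begin
    v k * ω K + σ * (v ∧ (ω ∘ (k ∷_))) K
      ≈⟨ +-cong (trans (*-congʳ p) (zeroˡ _))
                (trans (*-congˡ (∧-vanish (ω ∘ (k ∷_)) ps)) (zeroʳ σ)) ⟩
    0# + 0#  ≈⟨ +-identityˡ 0# ⟩
    0#       ∎

  -- The two outermost steps of a double exterior product.
  ∧-∧-expand : ∀ v u ω k K → (v ∧ u ∧ ω) (k ∷ K) ≈
    v k * (u ∧ ω) K + σ * (u k * (v ∧ ω) K + σ * (v ∧ u ∧ (ω ∘ (k ∷_))) K)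
  ∧-∧-expand v u ω k K = +-congˡ (*-congˡ (trans (∧.+-homo v K _ _)
    (+-cong (∧.*-homo v K (u k) ω) (∧.*-homo v K σ _))))

  ∧-alternating : ∀ v ω → v ∧ v ∧ ω ≋ λ _ → 0#
  ∧-alternating v ω []      = refl
  ∧-alternating v ω (k ∷ K) = begin
    (v ∧ v ∧ ω) (k ∷ K)  ≈⟨ ∧-∧-expand v v ω k K ⟩
    X + σ * (X + σ * (v ∧ v ∧ (ω ∘ (k ∷_))) K)
      ≈⟨ +-congˡ (*-congˡ (+-congˡ (*-congˡ (∧-alternating v (ω ∘ (k ∷_)) K)))) ⟩
    X + σ * (X + σ * 0#)
      ≈⟨ +-congˡ (*-congˡ (trans (+-congˡ (zeroʳ σ)) (+-identityʳ X))) ⟩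
    X + σ * X            ≈⟨ x+σx≈0 X ⟩
    0#                   ∎
    where X = v k * (v ∧ ω) K

  -- By ∧-∧-expand, exchanging v and u swaps the two terms V and U below up to
  -- σ, and the rest is the same claim for a shorter list.
  ∧-anticomm : ∀ v u ω → v ∧ u ∧ ω ≋ λ K → σ * (u ∧ v ∧ ω) K
  ∧-anticomm v u ω []      = sym (zeroʳ σ)
  ∧-anticomm v u ω (k ∷ K) = begin
    (v ∧ u ∧ ω) (k ∷ K)
      ≈⟨ ∧-∧-expand v u ω k K ⟩
    V + σ * (U + σ * (v ∧ u ∧ (ω ∘ (k ∷_))) K)
      ≈⟨ +-cong (trans (sym (*-identityˡ V)) (*-congʳ (sym σσ≈1)))
                (*-congˡ (+-congˡ (*-congˡ (∧-anticomm v u (ω ∘ (k ∷_)) K)))) ⟩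
    σ * σ * V + σ * (U + σ * (σ * Z))
      ≈⟨ solve 4 (λ s v u z → s :* s :* v :+ s :* (u :+ s :* (s :* z))
                           := s :* (u :+ s :* (v :+ s :* z))) refl σ V U Z ⟩
    σ * (U + σ * (V + σ * Z))
      ≈⟨ *-congˡ (∧-∧-expand u v ω k K) ⟨
    σ * (u ∧ v ∧ ω) (k ∷ K) ∎
    where
    V = v k * (u ∧ ω) K
    U = u k * (v ∧ ω) K
    Z = (u ∧ v ∧ (ω ∘ (k ∷_))) K

  -- A form of degree n vanishes on lists of length other than n.
  minors-length : ∀ M I K → length I ≢ length K → minors M I K ≈ 0#
  minors-length M []      []      I≢K = contradiction ≡.refl I≢K
  minors-length M []      (_ ∷ _) I≢K = refl
  minors-length M (i ∷ I) K       I≢K = wedge (M i) (minors M I) (length I) K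
    (minors-length M I) I≢K
    where
    wedge : ∀ v ω n K → (∀ L → n ≢ length L → ω L ≈ 0#) → suc n ≢ length K →
            (v ∧ ω) K ≈ 0#
    wedge v ω n       []      ω≈0 n≢K = refl
    wedge v ω n       (k ∷ K) ω≈0 n≢K = begin
      v k * ω K + σ * (v ∧ (ω ∘ (k ∷_))) K
        ≈⟨ +-cong (trans (*-congˡ (ω≈0 K (n≢K ∘ ≡.cong suc))) (zeroʳ _))
                  (trans (*-congˡ (rest n ω≈0 n≢K)) (zeroʳ σ)) ⟩
      0# + 0#  ≈⟨ +-identityˡ 0# ⟩
      0#       ∎
      where
      rest : ∀ n → (∀ L → n ≢ length L → ω L ≈ 0#) → suc n ≢ suc (length K) →
             (v ∧ (ω ∘ (k ∷_))) K ≈ 0#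
      rest zero    ω≈0 _   = trans (∧-congˡ {v} (λ L → ω≈0 (k ∷ L) λ ()) K) (∧.0-homo v K)
      rest (suc n) ω≈0 n≢K = wedge v (ω ∘ (k ∷_)) n K
        (λ L n≢L → ω≈0 (k ∷ L) (n≢L ∘ ℕ.suc-injective)) (n≢K ∘ ≡.cong suc)

  minors-cong-on : ∀ {p} {P : ℕ → Set p} {M N : ℕ → ℕ → Carrier} →
    (∀ i {k} → P k → M i k ≈ N i k) → ∀ I {K} → All P K → minors M I K ≈ minors N I K
  minors-cong-on M≈N []      ps = refl
  minors-cong-on M≈N (i ∷ I) ps = ∧-cong-on (M≈N i) (minors-cong-on M≈N I) ps

  -- The map of forms induced by v ↦ v N, where only the inner indices l with
  -- o ≤ l < o + n are summed over.  The basis form with rows l₁ < ... < lₘ in that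
  -- range goes to the exterior product of the rows l₁, ..., lₘ of N: a form splits
  -- into the part not involving the index o and the part starting with o, and
  -- the latter acquires the factor N o.
  push : (ℕ → ℕ → Carrier) → ℕ → ℕ → Form → Form
  push N o zero    ω []      = ω []
  push N o zero    ω (_ ∷ _) = 0#
  push N o (suc n) ω K       = push N (suc o) n ω K + (N o ∧ push N (suc o) n (ω ∘ (o ∷_))) K

  push-linear : ∀ N o n K → Linear (λ ω → push N o n ω K)
  push-linear N o zero    []      = evaluation-linear []
  push-linear N o zero    (_ ∷ _) = record
    { cong = λ _ → refl ; +-homo = λ _ _ → sym (+-identityˡ 0#) ; *-homo = λ a _ → sym (zeroʳ a) }
  push-linear N o (suc n) K = record
    { cong   = λ p → +-cong (P.cong K p)
        (∧.cong (N o) K λ L → P.cong L (p ∘ (o ∷_)))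
    ; +-homo = λ ω η → trans
        (+-cong (P.+-homo K ω η)
          (trans (∧.cong (N o) K λ L → P.+-homo L (ω ∘ (o ∷_)) (η ∘ (o ∷_)))
                 (∧.+-homo (N o) K _ _)))
        (solve 4 (λ a b c d → (a :+ b) :+ (c :+ d) := (a :+ c) :+ (b :+ d)) refl _ _ _ _)
    ; *-homo = λ a ω → trans
        (+-cong (P.*-homo K a ω)
          (trans (∧.cong (N o) K λ L → P.*-homo L a (ω ∘ (o ∷_)))
                 (∧.*-homo (N o) K a _)))
        (sym (distribˡ a _ _))
    }
    where module P K = Linear (push-linear N (suc o) n K)

  module push N o n K = Linear (push-linear N o n K)

  -- The sum of f l over o ≤ l < o + n.
  sumFrom : ℕ → ℕ → (ℕ → Carrier) → Carrier
  sumFrom o zero    f = 0#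
  sumFrom o (suc n) f = f o + sumFrom (suc o) n f

  sumFrom-zero : ∀ o n {f} → (∀ l → f l ≈ 0#) → sumFrom o n f ≈ 0#
  sumFrom-zero o zero    f≈0 = refl
  sumFrom-zero o (suc n) f≈0 =
    trans (+-cong (f≈0 o) (sumFrom-zero (suc o) n f≈0)) (+-identityˡ 0#)

  sumFrom-suc : ∀ o n f → sumFrom (suc o) n f ≡ sumFrom o n (f ∘ suc)
  sumFrom-suc o zero    f = ≡.refl
  sumFrom-suc o (suc n) f = ≡.cong (f (suc o) +_) (sumFrom-suc (suc o) n f)

  push-one : ∀ N o n → push N o n one ≋ one
  push-one N o zero    []      = refl
  push-one N o zero    (_ ∷ _) = refl
  push-one N o (suc n) K = trans
    (+-cong (push-one N (suc o) n K)
      (trans (∧.cong (N o) K (push.0-homo N (suc o) n)) (∧.0-homo (N o) K)))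
    (+-identityʳ _)

  -- The induced map commutes with exterior multiplication, the vector v being
  -- replaced by v N.  In the induction step the inner index o contributes the
  -- terms v o * N o ∧ _ directly; those coming from the remaining indices pass the
  -- factor N o by anticommutation, and N o ∧ N o vanishes.
  push-∧ : ∀ N o n v ω →
    push N o n (v ∧ ω) ≋ (λ k → sumFrom o n (λ l → v l * N l k)) ∧ push N o n ω
  push-∧ N o zero    v ω []      = refl
  push-∧ N o zero    v ω (k ∷ K) = sym (∧-vanish (push N o 0 ω) (All.universal (λ _ → refl) (k ∷ K)))
  push-∧ N o (suc n) v ω K = begin
    P (v ∧ ω) K + (N o ∧ P (λ L → v o * ω L + σ * (v ∧ ωₒ) L)) K
      ≈⟨ +-cong (push-∧ N (suc o) n v ω K)
           (∧.cong (N o) K λ L → trans (P.+-homo L _ _)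
             (+-cong (P.*-homo L (v o) ω)
                     (trans (P.*-homo L σ _) (*-congˡ (push-∧ N (suc o) n v ωₒ L))))) ⟩
    (w ∧ P ω) K + (N o ∧ (λ L → v o * P ω L + σ * (w ∧ P ωₒ) L)) K
      ≈⟨ +-congˡ (trans (∧.+-homo (N o) K _ _)
           (+-cong (∧.*-homo (N o) K (v o) _) (∧.*-homo (N o) K σ _))) ⟩
    (w ∧ P ω) K + (v o * (N o ∧ P ω) K + σ * (N o ∧ w ∧ P ωₒ) K)
      ≈⟨ +-congˡ (+-congˡ (sym (∧-anticomm w (N o) (P ωₒ) K))) ⟩
    (w ∧ P ω) K + (v o * (N o ∧ P ω) K + (w ∧ N o ∧ P ωₒ) K)
      -- The summand 0 makes room for the vanishing term N o ∧ N o ∧ P ωₒ.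
      ≈⟨ solve 4 (λ a v b d → a :+ (v :* b :+ d) := v :* (b :+ con 0) :+ (a :+ d)) refl
           _ (v o) _ _ ⟩
    v o * ((N o ∧ P ω) K + 0#) + ((w ∧ P ω) K + (w ∧ N o ∧ P ωₒ) K)
      ≈⟨ +-cong (*-congˡ (trans (+-congˡ (sym (∧-alternating (N o) (P ωₒ) K)))
                                (sym (∧.+-homo (N o) K _ _))))
                (sym (∧.+-homo w K _ _)) ⟩
    v o * (N o ∧ push N o (suc n) ω) K + (w ∧ push N o (suc n) ω) K
      ≈⟨ ∧-linearˡ (v o) (N o) w (push N o (suc n) ω) K ⟨
    ((λ k → v o * N o k + w k) ∧ push N o (suc n) ω) K ∎
    where
    P  = push N (suc o) n
    module P = push N (suc o) n
    ωₒ = ω ∘ (o ∷_)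
    w  = λ k → sumFrom (suc o) n (λ l → v l * N l k)

  -- The right-hand side consists of the minors of the product M N, with the
  -- inner index running over l < n.
  cauchy-binet : ∀ M N n I →
    push N 0 n (minors M I) ≋ minors (λ i k → sumFrom 0 n (λ l → M i l * N l k)) I
  cauchy-binet M N n []      K = push-one N 0 n K
  cauchy-binet M N n (i ∷ I) K = trans (push-∧ N 0 n (M i) (minors M I) K)
    (∧-congˡ (cauchy-binet M N n I) K)

  private
    module Σ = SemiringSum semiring
    open RawSemiring (Semiring.rawSemiring semiring) using (sum; _^_)

  -- The recursive definition of ∧ agrees with the alternating sum over the
  -- position of the removed column, as it occurs in the determinant.
  laplace : ∀ {n} v ω (c : Fin (suc n) → ℕ) →
    sum (λ j → σ ^ toℕ j * (v (c j) * ω (tabulate (c ∘ punchIn j)))) ≈ (v ∧ ω) (tabulate c)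
  laplace {zero}  v ω c = +-cong (*-identityˡ _) (sym (zeroʳ σ))
  laplace {suc n} v ω c = +-cong (*-identityˡ _) (begin
    sum (λ j → σ * σ ^ toℕ j * term j)    ≈⟨ Σ.sum-cong-≋ (λ j → *-assoc σ (σ ^ toℕ j) (term j)) ⟩
    sum (λ j → σ * (σ ^ toℕ j * term j))  ≈⟨ Σ.*-distribˡ-sum σ (λ j → σ ^ toℕ j * term j) ⟨
    σ * sum (λ j → σ ^ toℕ j * term j)
      ≈⟨ *-congˡ (laplace v (ω ∘ (c zero ∷_)) (c ∘ suc)) ⟩
    σ * (v ∧ (ω ∘ (c zero ∷_))) (tabulate (c ∘ suc)) ∎)
    where
    term : Fin (suc n) → Carrier
    term j = v (c (suc j)) * ω (c zero ∷ tabulate (c ∘ suc ∘ punchIn j))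

-- Minors of recursive matrices, and positivity

module OrderedForms {c ℓ ℓ′ : Level} (R : CommutativeRing c ℓ)
  (_≼_ : Rel (CommutativeRing.Carrier R) ℓ′) where

  open CommutativeRing R hiding (zero)
  open import Relation.Binary.Reasoning.Setoid setoid
  open Forms R
  open RawSemiring (Semiring.rawSemiring semiring) using (_^_)
  private
    module TP = TotalPositivity R _≼_
    module Solver = SemiringSolver commutativeSemiring
    open Solver using (solve; _:=_; _:+_; _:*_; con)

  det≈minors : ∀ {n} (M : TP.InfiniteMatrix) (rows cols : Fin n → ℕ) →
    TP.minor M rows cols ≈ minors M (tabulate rows) (tabulate cols)
  det≈minors {zero}  M rows cols = refl
  det≈minors {suc n} M rows cols = trans
    (Σ.sum-cong-≋ λ j → *-congˡ {x = σ ^ toℕ j} (*-congˡ {x = M (rows zero) (cols j)}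
       (det≈minors M (rows ∘ suc) (cols ∘ punchIn j))))
    (laplace (M (rows zero)) (minors M (tabulate (rows ∘ suc))) cols)
    where module Σ = SemiringSum semiring

  -- The row vector v times the tridiagonal matrix with entries r, s, t.
  tridiagonalStep : (r s t v : ℕ → Carrier) → ℕ → Carrier
  tridiagonalStep r s t v zero    = s 0 * v 0 + t 1 * v 1
  tridiagonalStep r s t v (suc k) =
    r (suc k) * v k + s (suc k) * v (suc k) + t (suc (suc k)) * v (suc (suc k))

  row-recurrence : ∀ r s t n k →
    TP.recursiveMatrix r s t (suc n) k ≡ tridiagonalStep r s t (TP.recursiveMatrix r s t n) k
  row-recurrence r s t n zero    = ≡.refl
  row-recurrence r s t n (suc k) = ≡.refl

  -- Removing row 0 and column 0 from a tridiagonal matrix leaves the one with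
  -- shifted sequences, so the sum is computed by induction on the column k.  The
  -- column is supported in rows up to k + 1, whence the bound on n.
  sumFrom-tridiagonal : ∀ r s t v k n → suc (suc k) ≤ n →
    sumFrom 0 n (λ l → v l * TP.coefficientMatrix r s t l k) ≈ tridiagonalStep r s t v k
  sumFrom-tridiagonal r s t v zero (suc zero)    (s≤s ())
  sumFrom-tridiagonal r s t v zero (suc (suc n)) _ = begin
    v 0 * s 0 + (v 1 * t 1 + sumFrom 2 n _)
      ≈⟨ +-congˡ (+-congˡ (begin
           sumFrom 2 n _  ≡⟨ sumFrom-suc 1 n _ ⟩
           sumFrom 1 n _  ≡⟨ sumFrom-suc 0 n _ ⟩
           sumFrom 0 n _  ≈⟨ sumFrom-zero 0 n (λ l → zeroʳ (v (suc (suc l)))) ⟩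
           0#             ∎)) ⟩
    v 0 * s 0 + (v 1 * t 1 + 0#)
      ≈⟨ solve 4 (λ a b c d → a :* b :+ (c :* d :+ con 0) := b :* a :+ d :* c) refl
           (v 0) (s 0) (v 1) (t 1) ⟩
    s 0 * v 0 + t 1 * v 1 ∎
  sumFrom-tridiagonal r s t v (suc k) (suc n) (s≤s k+2≤n) = begin
    v 0 * TP.coefficientMatrix r s t 0 (suc k) + sumFrom 1 n _
      ≈⟨ +-congˡ (reflexive (sumFrom-suc 0 n _)) ⟩
    v 0 * TP.coefficientMatrix r s t 0 (suc k)
      + sumFrom 0 n (λ l → v (suc l) * TP.coefficientMatrix (r ∘ suc) (s ∘ suc) (t ∘ suc) l k)
      ≈⟨ +-congˡ (sumFrom-tridiagonal (r ∘ suc) (s ∘ suc) (t ∘ suc) (v ∘ suc) k n k+2≤n) ⟩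
    v 0 * TP.coefficientMatrix r s t 0 (suc k)
      + tridiagonalStep (r ∘ suc) (s ∘ suc) (t ∘ suc) (v ∘ suc) k
      ≈⟨ top k ⟩
    tridiagonalStep r s t v (suc k) ∎
    where
    top : ∀ k → v 0 * TP.coefficientMatrix r s t 0 (suc k)
            + tridiagonalStep (r ∘ suc) (s ∘ suc) (t ∘ suc) (v ∘ suc) k ≈ tridiagonalStep r s t v (suc k)
    top zero    = trans (+-congʳ (*-comm (v 0) (r 1))) (sym (+-assoc _ _ _))
    top (suc k) = trans (+-congʳ (zeroʳ (v 0))) (+-identityˡ _)

  -- The truncation n of the inner index only has to cover the nonzero entries of
  -- J in the columns K.
  minors-shifted : ∀ r s t n I {K} → All (λ k → suc (suc k) ≤ n) K →
    let A = TP.recursiveMatrix r s t in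
    minors A (map suc I) K ≈ push (TP.coefficientMatrix r s t) 0 n (minors A I) K
  minors-shifted r s t n I {K} K<n = begin
    minors A (map suc I) K
      ≈⟨ rows-suc I K ⟩
    minors (A ∘ suc) I K
      ≈⟨ minors-cong-on (λ i {k} k<n → trans (reflexive (row-recurrence r s t i k))
           (sym (sumFrom-tridiagonal r s t (A i) k n k<n))) I K<n ⟩
    minors (λ i k → sumFrom 0 n (λ l → A i l * J l k)) I K
      ≈⟨ cauchy-binet A J n I K ⟨
    push J 0 n (minors A I) K ∎
    where
    A = TP.recursiveMatrix r s t
    J = TP.coefficientMatrix r s t
    rows-suc : ∀ I → minors A (map suc I) ≋ minors (A ∘ suc) I
    rows-suc []      K = refl
    rows-suc (i ∷ I) K = ∧-congˡ {A (suc i)} (rows-suc I) K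

  -- The properties of the order used below.  The last one relates it to the
  -- nonnegative elements: x ≼ y as soon as y - x is nonnegative.
  record IsCompatibleOrder : Set (c ⊔ ℓ ⊔ ℓ′) where
    field
      0≼-resp-≈ : ∀ {x y} → x ≈ y → 0# ≼ x → 0# ≼ y
      0≼0       : 0# ≼ 0#
      0≼1       : 0# ≼ 1#
      0≼+       : ∀ {x y} → 0# ≼ x → 0# ≼ y → 0# ≼ (x + y)
      0≼*       : ∀ {x y} → 0# ≼ x → 0# ≼ y → 0# ≼ (x * y)
      ≼-by-gap  : ∀ {x y z} → 0# ≼ z → y ≈ x + z → x ≼ y

  module _ (isCompatibleOrder : IsCompatibleOrder) where
    open IsCompatibleOrder isCompatibleOrder

    -- Positivity of push, tested by a functional Φ: if the coefficients of ω are
    -- nonnegative, and Φ is nonnegative on all minors of N with rows ≥ o, then Φ is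
    -- nonnegative on the image of ω.  Letting Φ vary makes the induction on n work:
    -- for the part of ω starting with the index o, it is applied to Φ ∘ (N o ∧_).
    push-nonneg : ∀ N o n {ω Φ} → Linear Φ →
      (∀ L → All (o ≤_) L → AllPairs _<_ L → (0# ≼ ω L) × (0# ≼ Φ (minors N L))) →
      0# ≼ Φ (push N o n ω)
    push-nonneg N o zero {ω} {Φ} Φ-lin h =
      let (0≤ω , 0≤Φ) = h [] [] []
      in 0≼-resp-≈ (sym (trans (Φ.cong only-empty) (Φ.*-homo (ω []) one))) (0≼* 0≤ω 0≤Φ)
      where
      module Φ = Linear Φ-lin
      only-empty : push N o 0 ω ≋ λ K → ω [] * one K
      only-empty []      = sym (*-identityʳ (ω []))
      only-empty (_ ∷ _) = sym (zeroʳ (ω []))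
    push-nonneg N o (suc n) {ω} {Φ} Φ-lin h =
      0≼-resp-≈ (sym (Φ.+-homo _ _)) (0≼+
        (push-nonneg N (suc o) n Φ-lin λ L o<L → h L (All.map ℕ.<⇒≤ o<L))
        (push-nonneg N (suc o) n (∘∧-linear (N o) Φ-lin) λ L o<L L↑ →
          h (o ∷ L) (ℕ.≤-refl ∷ All.map ℕ.<⇒≤ o<L) (o<L ∷ L↑)))
      where module Φ = Linear Φ-lin

    -- Nonnegativity of all minors of order at most p, for lists of rows and
    -- columns.  The lists may differ in length: such minors vanish.
    NonnegMinors : ℕ → TP.InfiniteMatrix → Set ℓ′
    NonnegMinors p M = ∀ I K → length I ≤ p → AllPairs _<_ I → AllPairs _<_ K →
      0# ≼ minors M I K

    -- An increasing list as a strictly increasing function on Fin.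
    enumerate : ∀ I → AllPairs _<_ I →
      ∃ λ (f : Fin (length I) → ℕ) → TP.StrictlyIncreasing f × tabulate f ≡ I
    enumerate I I↑ = lookup I , increasing I I↑ , tabulate-lookup I
      where
      increasing : ∀ I → AllPairs _<_ I → TP.StrictlyIncreasing (lookup I)
      increasing (i ∷ I) (i<I ∷ I↑) {zero}  {suc b} _         = All.lookup i<I (∈-lookup b)
      increasing (i ∷ I) (i<I ∷ I↑) {suc a} {suc b} (s≤s a<b) = increasing I I↑ a<b

    nonneg-of-equal-lengths : ∀ M I K →
      (length I ≡ length K → 0# ≼ minors M I K) → 0# ≼ minors M I K
    nonneg-of-equal-lengths M I K h with length I ℕ.≟ length K
    ... | yes I≡K = h I≡K
    ... | no  I≢K = 0≼-resp-≈ (sym (minors-length M I K I≢K)) 0≼0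

    -- For k ≥ 1, the minors given by strictly increasing functions on Fin k are
    -- those given by increasing lists of length k; the empty minor is 1.
    nonnegMinors⁺ : ∀ p {M} → (∀ k → 1 ≤ k → k ≤ p → TP.MinorsNonneg k M) → NonnegMinors p M
    nonnegMinors⁺ p {M} tp []        []      I≤p I↑ K↑ = 0≼1
    nonnegMinors⁺ p {M} tp []        (_ ∷ _) I≤p I↑ K↑ = 0≼0
    nonnegMinors⁺ p {M} tp I@(_ ∷ _) K       I≤p I↑ K↑ =
      let (f , f↑ , f≡I) = enumerate I I↑
          (g , g↑ , g≡K) = enumerate K K↑
      in nonneg-of-equal-lengths M I K λ I≡K → equal (length I) (s≤s z≤n) I≤p f f↑ f≡I
           (≡.subst (λ n → ∃ λ (g : Fin n → ℕ) → TP.StrictlyIncreasing g × tabulate g ≡ K)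
             (≡.sym I≡K) (g , (λ {a} {b} → g↑ {a} {b}) , g≡K))
      where
      equal : ∀ n → 1 ≤ n → n ≤ p → (f : Fin n → ℕ) → TP.StrictlyIncreasing f →
        tabulate f ≡ I → (∃ λ (g : Fin n → ℕ) → TP.StrictlyIncreasing g × tabulate g ≡ K) →
        0# ≼ minors M I K
      equal n 1≤n n≤p f f↑ f≡I (g , g↑ , g≡K) = 0≼-resp-≈
        (trans (det≈minors M f g) (reflexive (≡.cong₂ (minors M) f≡I g≡K)))
        (tp n 1≤n n≤p f g f↑ g↑)

    nonnegMinors⁻ : ∀ p {M} → NonnegMinors p M → ∀ k → k ≤ p → TP.MinorsNonneg k M
    nonnegMinors⁻ p {M} h k k≤p f g f↑ g↑ = 0≼-resp-≈ (sym (det≈minors M f g))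
      (h (tabulate f) (tabulate g) (≡.subst (_≤ p) (≡.sym (length-tabulate f)) k≤p)
         (AllPairs.tabulate⁺-< f↑) (AllPairs.tabulate⁺-< g↑))

    unshift : ∀ I → All (0 <_) I → ∃ λ I′ → I ≡ map suc I′
    unshift []          []       = [] , ≡.refl
    unshift (suc i ∷ I) (_ ∷ ps) =
      let (I′ , eq) = unshift I ps in i ∷ I′ , ≡.cong (suc i ∷_) eq

    columnBound : ∀ K → ∃ λ n → All (λ k → suc (suc k) ≤ n) K
    columnBound []      = 0 , []
    columnBound (k ∷ K) =
      let (n , K<n) = columnBound K
      in suc (suc k) ℕ.⊔ n , ℕ.m≤m⊔n (suc (suc k)) n ∷
           All.map (λ k<n → ℕ.≤-trans k<n (ℕ.m≤n⊔m (suc (suc k)) n)) K<n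

    module _ (r s t : ℕ → Carrier) where
      private
        A = TP.recursiveMatrix r s t
        J = TP.coefficientMatrix r s t

      -- Induction on the strict bound m for the rows.  Lists of positive rows with
      -- bound suc m are treated by nonnegMinors-shifted, which returns to the bound m.
      nonnegMinors-below : ∀ p → NonnegMinors p J → ∀ m I K → All (_< m) I →
        length I ≤ p → AllPairs _<_ I → AllPairs _<_ K → 0# ≼ minors A I K

      nonnegMinors-shifted : ∀ p → NonnegMinors p J → ∀ m I K → All (0 <_) I →
        All (_< suc m) I → length I ≤ p → AllPairs _<_ I → AllPairs _<_ K →
        0# ≼ minors A I K
      nonnegMinors-shifted p hJ m I K 0<I I<m I≤p I↑ K↑ with unshift I 0<I
      ... | I′ , ≡.refl =
        nonneg-of-equal-lengths A (map suc I′) K λ I≡K →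
        let (n , K<n) = columnBound K
            I′≤p = ≡.subst (_≤ p) (length-map suc I′) I≤p
        in 0≼-resp-≈ (sym (minors-shifted r s t n I′ K<n))
             (push-nonneg J 0 n (evaluation-linear K) λ L _ L↑ →
                nonnegMinors-below p hJ m I′ L (All.map ℕ.≤-pred (All.map⁻ I<m)) I′≤p
                  (AllPairs.map ℕ.≤-pred (AllPairs.map⁻ I↑)) L↑ ,
                nonneg-of-equal-lengths J L K λ L≡K →
                  hJ L K (≡.subst (_≤ p) (≡.trans I≡K (≡.sym L≡K)) I≤p) L↑ K↑)

      nonnegMinors-below p hJ m       []         []      _        _ _ _ = 0≼1
      nonnegMinors-below p hJ m       []         (_ ∷ _) _        _ _ _ = 0≼0
      nonnegMinors-below p hJ zero    (_ ∷ _)    K       (() ∷ _) _ _ _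
      nonnegMinors-below p hJ (suc m) (zero ∷ I) [] _ _ _ _ = 0≼0
      -- Row 0 is (1, 0, 0, ...), so only the term removing column 0 survives.
      nonnegMinors-below p hJ (suc m) (zero ∷ I) (zero ∷ K)
        (_ ∷ I<m) I≤p (0<I ∷ I↑) (0<K ∷ K↑) =
        0≼-resp-≈ (sym (trans (+-cong (*-identityˡ _)
            (trans (*-congˡ (∧-vanish _ (All.map (λ { (s≤s _) → refl }) 0<K))) (zeroʳ σ)))
            (+-identityʳ _)))
          (nonnegMinors-shifted p hJ m I K 0<I I<m (ℕ.<⇒≤ I≤p) I↑ K↑)
      -- Row 0 vanishes at all columns in question.
      nonnegMinors-below p hJ (suc m) (zero ∷ I) (suc k ∷ K) _ _ _ (k<K ∷ K↑) =
        0≼-resp-≈ (sym (∧-vanish (minors A I) {suc k ∷ K}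
          (refl ∷ All.map (λ { (s≤s _) → refl }) k<K))) 0≼0
      nonnegMinors-below p hJ (suc m) I@(suc i ∷ I₁) K I<m I≤p I↑@(i<I ∷ _) K↑ =
        nonnegMinors-shifted p hJ m I K (s≤s z≤n ∷ All.map (λ { (s≤s _) → s≤s z≤n }) i<I)
          I<m I≤p I↑ K↑

      nonnegMinors-recursive : ∀ p → NonnegMinors p J → NonnegMinors p A
      nonnegMinors-recursive p hJ I K =
        let (m , I<m) = rowBound I in nonnegMinors-below p hJ m I K I<m
        where
        rowBound : ∀ I → ∃ λ m → All (_< m) I
        rowBound I = let (n , I<n) = columnBound I in n , All.map ℕ.<⇒≤ I<n

      recursiveMatrix-TP[_] : ∀ p → TP.TP[ p ] J → TP.TP[ p ] A
      recursiveMatrix-TP[ p ] tp k _ k≤p =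
        nonnegMinors⁻ p (nonnegMinors-recursive p (nonnegMinors⁺ p tp)) k k≤p

      -- A minor of order k only needs total positivity of order k.
      recursiveMatrix-TP : TP.TP J → TP.TP A
      recursiveMatrix-TP tp k 1≤k =
        recursiveMatrix-TP[ k ] (λ k 1≤k _ → tp k 1≤k) k 1≤k ℕ.≤-refl

      catalanLike-logConvex : 0# ≼ t 1 → TP.TP[ 2 ] A → TP.LogConvex (TP.catalanLike r s t)
      catalanLike-logConvex 0≤t₁ tp = entry , logConvex
        where
        hA : NonnegMinors 2 A
        hA = nonnegMinors⁺ 2 tp
        entry : ∀ n → 0# ≼ A n 0
        entry n = 0≼-resp-≈
          (trans (+-cong (*-identityʳ (A n 0)) (zeroʳ σ)) (+-identityʳ (A n 0)))
          (hA (n ∷ []) (0 ∷ []) (s≤s z≤n) ([] ∷ []) ([] ∷ []))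
        logConvex : ∀ i j → i < j → (A (suc i) 0 * A j 0) ≼ (A i 0 * A (suc j) 0)
        logConvex i j i<j = ≼-by-gap
          (0≼* 0≤t₁ (hA (i ∷ j ∷ []) (0 ∷ 1 ∷ []) ℕ.≤-refl
            ((i<j ∷ []) ∷ [] ∷ []) ((s≤s z≤n ∷ []) ∷ [] ∷ [])))
          (begin
            A i 0 * (s 0 * A j 0 + t 1 * A j 1)
              ≈⟨ +-identityʳ _ ⟨
            A i 0 * (s 0 * A j 0 + t 1 * A j 1) + 0#
              ≈⟨ +-congˡ (x+σx≈0 (t 1 * A i 1 * A j 0)) ⟨
            A i 0 * (s 0 * A j 0 + t 1 * A j 1)
              + (t 1 * A i 1 * A j 0 + σ * (t 1 * A i 1 * A j 0))
              ≈⟨ solve 7 (λ s₀ t₁ aᵢ bᵢ aⱼ bⱼ σ →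
                   aᵢ :* (s₀ :* aⱼ :+ t₁ :* bⱼ) :+ (t₁ :* bᵢ :* aⱼ :+ σ :* (t₁ :* bᵢ :* aⱼ))
                   := (s₀ :* aᵢ :+ t₁ :* bᵢ) :* aⱼ
                        :+ t₁ :* (aᵢ :* (bⱼ :* con 1 :+ σ :* con 0)
                          :+ σ :* (bᵢ :* (aⱼ :* con 1 :+ σ :* con 0) :+ σ :* con 0)))
                   refl (s 0) (t 1) (A i 0) (A i 1) (A j 0) (A j 1) σ ⟩
            (s 0 * A i 0 + t 1 * A i 1) * A j 0
              + t 1 * minors A (i ∷ j ∷ []) (0 ∷ 1 ∷ []) ∎)

-- The order of the real numbers

private
  half-pos : ∀ {ε} → 0ℚ ℚ.< ε → 0ℚ ℚ.< ½ ℚ.* ε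
  half-pos {ε} 0<ε = ℚ.positive⁻¹ (½ ℚ.* ε) {{ℚ.pos*pos⇒pos ½ ε {{ℚ.positive 0<ε}}}}

  halves : ∀ ε → ½ ℚ.* ε ℚ.+ ½ ℚ.* ε ≡ ε
  halves ε = ≡.trans (≡.sym (ℚ.*-distribʳ-+ ε ½ ½)) (ℚ.*-identityˡ ε)

  divide : ∀ B {ε} → 0ℚ ℚ.< B → 0ℚ ℚ.< ε → ∃ λ δ → (0ℚ ℚ.< δ) × (B ℚ.* δ ≡ ε)
  divide B {ε} 0<B 0<ε = δ , ℚ.positive⁻¹ δ , (begin
      B ℚ.* (ℚ.1/ B ℚ.* ε)  ≡⟨ ℚ.*-assoc B (ℚ.1/ B) ε ⟨
      B ℚ.* ℚ.1/ B ℚ.* ε    ≡⟨ ≡.cong (ℚ._* ε) (ℚ.*-inverseʳ B) ⟩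
      1ℚ ℚ.* ε              ≡⟨ ℚ.*-identityˡ ε ⟩
      ε                     ∎)
    where
    open ≡.≡-Reasoning
    instance
      B-pos : ℚ.Positive B
      B-pos = ℚ.positive 0<B
      B≢0 : ℚ.NonZero B
      B≢0 = ℚ.pos⇒nonZero B
    δ = ℚ.1/ B ℚ.* ε
    instance
      δ-pos : ℚ.Positive δ
      δ-pos = ℚ.pos*pos⇒pos (ℚ.1/ B) {{ℚ.1/pos⇒pos B}} ε {{ℚ.positive 0<ε}}

  eventually-∧ : ∀ {P Q R : ℕ → Set} → (∀ n → P n → Q n → R n) →
    Eventually P → Eventually Q → Eventually R
  eventually-∧ f (M , p) (N , q) = M ℕ.⊔ N , λ n h →
    f n (p n (ℕ.m⊔n≤o⇒m≤o M N h)) (q n (ℕ.m⊔n≤o⇒n≤o M N h))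

  p≤∣p∣ : ∀ p → p ℚ.≤ ∣ p ∣
  p≤∣p∣ p with ℚ.≤-total 0ℚ p
  ... | inj₁ 0≤p = ℚ.≤-reflexive (≡.sym (ℚ.0≤p⇒∣p∣≡p 0≤p))
  ... | inj₂ p≤0 = ℚ.≤-trans p≤0 (ℚ.0≤∣p∣ p)

  open ℚ.≤-Reasoning
  open +-*-Solver using (solve; _:=_; _:+_; _:*_; :-_)

  ∣p-q∣≤ε⇒p≤q+ε : ∀ p q {ε} → ∣ p ℚ.- q ∣ ℚ.≤ ε → p ℚ.≤ q ℚ.+ ε
  ∣p-q∣≤ε⇒p≤q+ε p q {ε} h = begin
    p                  ≡⟨ solve 2 (λ p q → p := q :+ (p :+ :- q)) ≡.refl p q ⟩
    q ℚ.+ (p ℚ.- q)    ≤⟨ ℚ.+-monoʳ-≤ q (ℚ.≤-trans (p≤∣p∣ (p ℚ.- q)) h) ⟩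
    q ℚ.+ ε            ∎

  p≤q⇒0≤q-p : ∀ {p q} → p ℚ.≤ q → 0ℚ ℚ.≤ q ℚ.- p
  p≤q⇒0≤q-p {p} {q} p≤q =
    ≡.subst (ℚ._≤ q ℚ.- p) (ℚ.+-inverseʳ p) (ℚ.+-monoˡ-≤ (ℚ.- p) p≤q)

  0≤p*q : ∀ {p q} → 0ℚ ℚ.≤ p → 0ℚ ℚ.≤ q → 0ℚ ℚ.≤ p ℚ.* q
  0≤p*q {p} {q} 0≤p 0≤q = ℚ.nonNegative⁻¹ (p ℚ.* q)
    {{ℚ.nonNeg*nonNeg⇒nonNeg p {{ℚ.nonNegative 0≤p}} q {{ℚ.nonNegative 0≤q}}}}

  -- A product of numbers that are nonnegative up to δ is so up to B * δ, if B
  -- bounds both absolute values.  If one of x, y is nonnegative, then the product is at least - δ times that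
  -- one; otherwise both are nonpositive, and the product is nonnegative.
  product-slack : ∀ x y {B δ} → 0ℚ ℚ.≤ δ → 0ℚ ℚ.≤ x ℚ.+ δ → 0ℚ ℚ.≤ y ℚ.+ δ →
    ∣ x ∣ ℚ.≤ B → ∣ y ∣ ℚ.≤ B → 0ℚ ℚ.≤ x ℚ.* y ℚ.+ B ℚ.* δ
  product-slack x y {B} {δ} 0≤δ 0≤x+δ 0≤y+δ x≤B y≤B with ℚ.≤-total 0ℚ x | ℚ.≤-total 0ℚ y
  ... | inj₂ x≤0 | inj₂ y≤0 = begin
    0ℚ                            ≤⟨ ℚ.+-mono-≤ (0≤p*q (ℚ.neg-antimono-≤ x≤0) (ℚ.neg-antimono-≤ y≤0))
                                       (0≤p*q (ℚ.≤-trans (ℚ.0≤∣p∣ x) x≤B) 0≤δ) ⟩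
    ℚ.- x ℚ.* ℚ.- y ℚ.+ B ℚ.* δ
      ≡⟨ solve 3 (λ x y b → :- x :* :- y :+ b := x :* y :+ b) ≡.refl x y (B ℚ.* δ) ⟩
    x ℚ.* y ℚ.+ B ℚ.* δ           ∎
  ... | inj₁ 0≤x | _ = begin
    0ℚ                                    ≤⟨ ℚ.+-mono-≤ (0≤p*q 0≤y+δ 0≤x)
      (0≤p*q (p≤q⇒0≤q-p (ℚ.≤-trans (p≤∣p∣ x) x≤B)) 0≤δ) ⟩
    (y ℚ.+ δ) ℚ.* x ℚ.+ (B ℚ.- x) ℚ.* δ
      ≡⟨ solve 4 (λ x y b d → (y :+ d) :* x :+ (b :+ :- x) :* d := x :* y :+ b :* d) ≡.refl x y B δ ⟩
    x ℚ.* y ℚ.+ B ℚ.* δ                   ∎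
  ... | _ | inj₁ 0≤y = begin
    0ℚ                                    ≤⟨ ℚ.+-mono-≤ (0≤p*q 0≤x+δ 0≤y)
      (0≤p*q (p≤q⇒0≤q-p (ℚ.≤-trans (p≤∣p∣ y) y≤B)) 0≤δ) ⟩
    (x ℚ.+ δ) ℚ.* y ℚ.+ (B ℚ.- y) ℚ.* δ
      ≡⟨ solve 4 (λ x y b d → (x :+ d) :* y :+ (b :+ :- y) :* d := x :* y :+ b :* d) ≡.refl x y B δ ⟩
    x ℚ.* y ℚ.+ B ℚ.* δ                   ∎

≃ℝ⇒≤ℝ : ∀ {x y} → x ≃ℝ y → x ≤ℝ y
≃ℝ⇒≤ℝ {x} {y} x≃y = mk≤ λ ε 0<ε → let (N , h) = close x≃y ε 0<ε in
  N , λ n N≤n → ∣p-q∣≤ε⇒p≤q+ε (seq x n) (seq y n) (h n N≤n)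

≤ℝ-trans : ∀ {x y z} → x ≤ℝ y → y ≤ℝ z → x ≤ℝ z
≤ℝ-trans {x} {y} {z} x≤y y≤z = mk≤ λ ε 0<ε → eventually-∧
  (λ n p q → begin
    seq x n                              ≤⟨ p ⟩
    seq y n ℚ.+ ½ ℚ.* ε                  ≤⟨ ℚ.+-monoˡ-≤ (½ ℚ.* ε) q ⟩
    seq z n ℚ.+ ½ ℚ.* ε ℚ.+ ½ ℚ.* ε      ≡⟨ ℚ.+-assoc (seq z n) (½ ℚ.* ε) (½ ℚ.* ε) ⟩
    seq z n ℚ.+ (½ ℚ.* ε ℚ.+ ½ ℚ.* ε)    ≡⟨ ≡.cong (seq z n ℚ.+_) (halves ε) ⟩
    seq z n ℚ.+ ε                        ∎)
  (below x≤y (½ ℚ.* ε) (half-pos 0<ε)) (below y≤z (½ ℚ.* ε) (half-pos 0<ε))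

x≤ℝx+z : ∀ {x z} → 0ℝ ≤ℝ z → x ≤ℝ x +ℝ z
x≤ℝx+z {x} {z} 0≤z = mk≤ λ ε 0<ε → let (N , h) = below 0≤z ε 0<ε in
  N , λ n N≤n → begin
    seq x n                        ≡⟨ ℚ.+-identityʳ (seq x n) ⟨
    seq x n ℚ.+ 0ℚ                 ≤⟨ ℚ.+-monoʳ-≤ (seq x n) (h n N≤n) ⟩
    seq x n ℚ.+ (seq z n ℚ.+ ε)    ≡⟨ ℚ.+-assoc (seq x n) (seq z n) ε ⟨
    seq x n ℚ.+ seq z n ℚ.+ ε      ∎

0≤ℝ* : ∀ {x y} → 0ℝ ≤ℝ x → 0ℝ ≤ℝ y → 0ℝ ≤ℝ x *ℝ y
0≤ℝ* {x} {y} 0≤x 0≤y = mk≤ λ ε 0<ε →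
  let (B , 0<B , x≤B) = bounded x
      (C , 0<C , y≤C) = bounded y
      B≤B+C = ≡.subst (ℚ._≤ B ℚ.+ C) (ℚ.+-identityʳ B) (ℚ.+-monoʳ-≤ B (ℚ.<⇒≤ 0<C))
      C≤B+C = ≡.subst (ℚ._≤ B ℚ.+ C) (ℚ.+-identityˡ C) (ℚ.+-monoˡ-≤ C (ℚ.<⇒≤ 0<B))
      (δ , 0<δ , eq)  = divide (B ℚ.+ C) (ℚ.<-≤-trans 0<B B≤B+C) 0<ε
  in eventually-∧
    (λ n (x≤B , y≤C) (0≤x+δ , 0≤y+δ) → ≡.subst (λ e → 0ℚ ℚ.≤ seq x n ℚ.* seq y n ℚ.+ e) eq
      (product-slack (seq x n) (seq y n) (ℚ.<⇒≤ 0<δ) 0≤x+δ 0≤y+δ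
        (ℚ.≤-trans x≤B B≤B+C) (ℚ.≤-trans y≤C C≤B+C)))
    (eventually-∧ (λ _ → _,_) x≤B y≤C)
    (eventually-∧ (λ _ → _,_) (below 0≤x δ 0<δ) (below 0≤y δ 0<δ))

private
  module ℝ-Ring = CommutativeRing ℝ-commutativeRing
  open OrderedForms ℝ-commutativeRing _≤ℝ_

≤ℝ-isCompatibleOrder : IsCompatibleOrder
≤ℝ-isCompatibleOrder = record
  { 0≼-resp-≈ = λ x≃y 0≤x → ≤ℝ-trans 0≤x (≃ℝ⇒≤ℝ x≃y)
  ; 0≼0       = ≃ℝ⇒≤ℝ ℝ-Ring.refl
  ; 0≼1       = mk≤ λ ε 0<ε → 0 , λ _ _ →
      ℚ.+-mono-≤ {0ℚ} {1ℚ} {0ℚ} {ε} (ℚ.nonNegative⁻¹ 1ℚ) (ℚ.<⇒≤ 0<ε)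
  ; 0≼+       = λ 0≤x 0≤y → ≤ℝ-trans 0≤x (x≤ℝx+z 0≤y)
  ; 0≼*       = 0≤ℝ*
  ; ≼-by-gap  = λ 0≤z y≃x+z → ≤ℝ-trans (x≤ℝx+z 0≤z) (≃ℝ⇒≤ℝ (ℝ-Ring.sym y≃x+z))
  }

theorem2p3 :
  (r s t : ℕ → ℝ) →
  (∀ k → 1 ≤ k → 0ℝ ≤ℝ r k) →
  (∀ k → 0ℝ ≤ℝ s k) →
  (∀ k → 1 ≤ k → 0ℝ ≤ℝ t k) →
  let A = recursiveMatrix r s t
      J = coefficientMatrix r s t
  in ((∀ p → 1 ≤ p → TP[ p ] J → TP[ p ] A) × (TP J → TP A))
     × (TP[ 2 ] A → LogConvex (catalanLike r s t))
theorem2p3 r s t 0≤r 0≤s 0≤t =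
  ((λ p _ → recursiveMatrix-TP[_] ord r s t p) , recursiveMatrix-TP ord r s t) ,
  catalanLike-logConvex ord r s t (0≤t 1 ℕ.≤-refl)
  where ord = ≤ℝ-isCompatibleOrder
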